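{- Let $\mathbb{A}$ be a finite alphabet and let $\varphi$ be an $\mathrm{LTL}^{\le}$-formula over $\mathbb{A}$. Then the cost function $[\![\varphi]\!]^{\approx}$ is recognized by a $B$-automaton, i.e. there is a $B$-automaton $\mathcal{A}$ over $\mathbb{A}$ with $[\![\mathcal{A}]\!]_B\approx[\![\varphi]\!]$; hence $[\![\varphi]\!]^{\approx}$ is a regular cost function. Moreover, if non-atomic actions are allowed on transitions, there is such a $B$-automaton $\mathcal{A}_\varphi$ that preserves the exact semantics of $\varphi$: $[\![\mathcal{A}_\varphi]\!]_B(u)=[\![\varphi]\!](u)$ for every $u\in\mathbb{A}^*$.
   Context: **Cost functions.** $\mathbb{N}_\infty=\mathbb{N}\cup\{\infty\}$. A set $X\subseteq\mathbb{N}_\infty$ is bounded if there is $N\in\mathbb{N}$ with $x<N$ for all $x\in X$. For $f,g:\mathbb{A}^*\to\mathbb{N}_\infty$, write $f\preccurlyeq g$ if for every $W\subseteq\mathbb{A}^*$, $g(W)$ bounded implies $f(W)$ bounded; $f\approx g$ means $f\preccurlyeq g$ and $g\preccurlyeq f$. A cost function is a $\approx$-class; $f^{\approx}$ is the class of $f$. **$\mathrm{LTL}^{\le}$ (on finite words).** Formulas: $\varphi::=a\mid\varphi\wedge\varphi\mid\varphi\vee\varphi\mid X\varphi\mid\varphi U\varphi\mid\varphi U^{\le N}\varphi\mid\Omega$, with $a\in\mathbb{A}$, where $N$ is a single free variable common to all occurrences of $U^{\le N}$. For $u\in\mathbb{A}^*$, $n\in\mathbb{N}$, $(u,n)\models\varphi$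 is defined by: $(u,n)\models a$ iff $u\in a\mathbb{A}^*$; $(u,n)\models\Omega$ iff $u$ is the empty word; $\wedge,\vee$ are conjunction and disjunction; $(u,n)\models X\varphi$ iff $u=av$ with $a\in\mathbb{A}$ and $(v,n)\models\varphi$; $(u,n)\models\varphi U\psi$ iff $u=yz$ with $(z,n)\models\psi$ and $(y''z,n)\models\varphi$ for every nonempty suffix $y''$ of $y$ ($y$ and $z$ may be empty); $(u,n)\models\varphi U^{\le N}\psi$ iff $u=yz$ with $(z,n)\models\psi$ and $(y''z,n)\not\models\varphi$ for at most $n$ nonempty suffixes $y''$ of $y$. Finally $[\![\varphi]\!](u)=\inf\{n\in\mathbb{N}:(u,n)\models\varphi\}$, with $\inf\emptyset=\infty$. **$B$-automata.** A $B$-automaton is $\langle Q,\mathbb{A},\mathit{In},\mathit{Fin},\Gamma,\Delta\rangle$ with finite sets of states $Q$ and counters $\Gamma$, initial and final states $\mathit{In},\mathit{Fin}\subseteq Q$, and transitions $\Delta\subseteq Q\times\mathbb{A}\times\{\varepsilon,\mathtt{ic},\mathtt{r}\}^\Gamma\times Q$ ($\Delta$ finite). Counters start at $0$; $\mathtt{ic}$ increments by $1$ and records the new value, $\mathtt{r}$ resets to $0$, $\varepsilon$ does nothing. For a run $e$, $C(e)$ is the set of values recorded on any counter during $e$. $[\![\mathcal{A}]\!]_B(u)=\inf\{\sup C(e): e\text{ an accepting run of }\mathcal{A}\text{ on }u\}$ with $\sup\emptyset=0$, $\inf\emptyset=\infty$ (an accepting run goes from a state of $\mathit{In}$ to a state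 of $\mathit{Fin}$). Allowing non-atomic actions means that each transition may carry, for each counter, a finite sequence of atomic actions (a word of $\{\varepsilon,\mathtt{ic},\mathtt{r}\}^*$), executed in order. A cost function $F$ is recognized by $\mathcal{A}$ if $F=[\![\mathcal{A}]\!]_B^{\approx}$; it is regular if it is recognized by some $B$-automaton (with atomic actions). -}

module Defs where

open import Data.Fin.Base using (Fin)
import Data.Fin.Properties as Fin
open import Data.Fin.Subset using (Subset) renaming (_∈_ to _∈ₛ_)
open import Data.Fin.Subset.Properties using () renaming (_∈?_ to _∈ₛ?_)
open import Data.List.Base
  using (List; []; _∷_; _++_; length; map; filter; concat; upTo; allFin)
import Data.List.Extrema
open import Data.List.Extrema.Nat using (max)
open import Data.List.Membership.Propositional using (_∈_; mapWith∈; lose)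
open import Data.List.Membership.Propositional.Properties
  using (∈-map⁺; ∈-filter⁺; ∈-concat⁺′; ∈-upTo⁺; ∈-allFin)
open import Data.List.Properties using (length-filter; length-++)
open import Data.List.Relation.Unary.All as All using (All; []; _∷_)
import Data.List.Relation.Unary.All.Properties as All
open import Data.List.Relation.Unary.Any using (Any; here)
open import Data.List.Relation.Unary.Any.Properties using (mapWith∈⁺)
open import Data.Nat.Base using (ℕ; suc; _≤_; _<_; _⊓_; z≤n; s≤s)
import Data.Nat.Properties as ℕ
open import Data.Product.Base using (∃; ∃₂; _×_; _,_; proj₁; proj₂)
open import Data.Sum.Base using (_⊎_; inj₁; inj₂)
open import Data.Vec.Base as Vec using (Vec)
open import Level using (0ℓ)
open import Relation.Binary.Bundles using (TotalOrder)
import Relation.Binary.Construct.Add.Supremum.NonStrict _≤_ as NonStrict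
import Relation.Binary.Construct.Add.Supremum.Strict _<_ as Strict
open import Relation.Binary.PropositionalEquality
  using (_≡_; refl; sym; cong; subst; ≡-≟-identity)
open import Relation.Nullary using (Dec; yes; no; contradiction)
open import Relation.Nullary.Construct.Add.Supremum using (_⁺; [_]; ⊤⁺)
open import Relation.Nullary.Decidable using (map′; ¬?; _×-dec_; _⊎-dec_)
open import Relation.Unary using (Pred; Decidable)

-- The alphabet with k letters is Fin k.

Word : ℕ → Set
Word k = List (Fin k)

ℕ∞ : Set
ℕ∞ = ℕ ⁺

open NonStrict public using () renaming (_≤⁺_ to _≤∞_)
open Strict public using () renaming (_<⁺_ to _<∞_)

record IsInf (S : Pred ℕ∞ 0ℓ) (m : ℕ∞) : Set where
  field
    lower    : ∀ {s} → S s → m ≤∞ s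
    greatest : ∀ {l} → (∀ {s} → S s → l ≤∞ s) → l ≤∞ m

private
  ≤∞-totalOrder : TotalOrder 0ℓ 0ℓ 0ℓ
  ≤∞-totalOrder = record
    { isTotalOrder = NonStrict.≤⁺-isTotalOrder-≡ ℕ.≤-isTotalOrder }

  module ∞ where
    open TotalOrder ≤∞-totalOrder public using () renaming (refl to ≤-refl)
    open Data.List.Extrema ≤∞-totalOrder public

-- Infima of arbitrary subsets of ℕ∞ do not exist constructively; they do when S
-- has a finite coinitial subset, as is the case for every infimum taken below.

infimum : (S : Pred ℕ∞ 0ℓ) (xs : List ℕ∞) → All S xs →
          (∀ {s} → S s → Any (_≤∞ s) xs) → ∃ (IsInf S)
infimum S xs sound coinitial = ∞.min ⊤⁺ xs , record
  { lower    = λ s∈S → ∞.min≤v⁺ ⊤⁺ xs (inj₂ (coinitial s∈S))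
  ; greatest = λ {l} bound → ∞.v≤min⁺ (NonStrict._≤⊤⁺ l) (All.map bound sound)
  }

Bounded : Pred ℕ∞ 0ℓ → Set
Bounded X = ∃ λ (N : ℕ) → ∀ {x} → X x → x <∞ [ N ]

image : ∀ {A : Set} → (A → ℕ∞) → Pred A 0ℓ → Pred ℕ∞ 0ℓ
image f W x = ∃ λ u → W u × f u ≡ x

infix 4 _≼_ _≈_

_≼_ : ∀ {k} (f g : Word k → ℕ∞) → Set₁
_≼_ {k} f g = ∀ (W : Pred (Word k) 0ℓ) → Bounded (image g W) → Bounded (image f W)

-- The cost function f^≈ is represented by f, equality of cost functions being ≈.

_≈_ : ∀ {k} (f g : Word k → ℕ∞) → Set₁
f ≈ g = f ≼ g × g ≼ f

infixr 6 _∧_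
infixr 5 _∨_
infixr 7 _U_ _U≤N_

data LTL≤ (k : ℕ) : Set where
  letter  : Fin k → LTL≤ k
  _∧_ _∨_ : LTL≤ k → LTL≤ k → LTL≤ k
  X       : LTL≤ k → LTL≤ k
  _U_     : LTL≤ k → LTL≤ k → LTL≤ k
  _U≤N_   : LTL≤ k → LTL≤ k → LTL≤ k
  Ω       : LTL≤ k

suffixes⁺ : ∀ {A : Set} → List A → List (List A)
suffixes⁺ []      = []
suffixes⁺ (a ∷ y) = (a ∷ y) ∷ suffixes⁺ y

private
  split? : ∀ {A : Set} {P : List A → List A → Set} → (∀ y z → Dec (P y z)) →
           ∀ u → Dec (∃₂ λ y z → u ≡ y ++ z × P y z)
  split? P? [] = map′ (λ p → [] , [] , refl , p)
                      (λ { ([] , [] , refl , p) → p }) (P? [] [])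
  split? P? (a ∷ u) = map′
    (λ { (inj₁ p) → [] , a ∷ u , refl , p
       ; (inj₂ (y , z , refl , p)) → a ∷ y , z , refl , p })
    (λ { ([] , _ , refl , p) → inj₁ p
       ; (_ ∷ y , z , refl , p) → inj₂ (y , z , refl , p) })
    (P? [] (a ∷ u) ⊎-dec split? (λ y → P? (a ∷ y)) u)

infix 4 _⊨_ _⊨?_

-- Satisfaction is defined together with its decidability, which is used to
-- count the suffixes where φ fails in φ U≤N ψ (suffixes⁺ y has no repetitions).

_⊨_  : ∀ {k} → Word k × ℕ → LTL≤ k → Set
_⊨?_ : ∀ {k} (un : Word k × ℕ) (φ : LTL≤ k) → Dec (un ⊨ φ)

(u , n) ⊨ letter a  = ∃ λ v → u ≡ a ∷ v
(u , n) ⊨ φ ∧ ψ     = (u , n) ⊨ φ × (u , n) ⊨ ψ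
(u , n) ⊨ φ ∨ ψ     = (u , n) ⊨ φ ⊎ (u , n) ⊨ ψ
(u , n) ⊨ X φ       = ∃₂ λ a v → u ≡ a ∷ v × (v , n) ⊨ φ
(u , n) ⊨ φ U ψ     = ∃₂ λ y z → u ≡ y ++ z × (z , n) ⊨ ψ ×
                        All (λ y″ → (y″ ++ z , n) ⊨ φ) (suffixes⁺ y)
(u , n) ⊨ φ U≤N ψ   = ∃₂ λ y z → u ≡ y ++ z × (z , n) ⊨ ψ ×
                        length (filter (λ y″ → ¬? ((y″ ++ z , n) ⊨? φ)) (suffixes⁺ y)) ≤ n
(u , n) ⊨ Ω         = u ≡ []

([] , n) ⊨? letter a     = no λ ()
(b ∷ v , n) ⊨? letter a  = map′ (λ { refl → v , refl }) (λ { (_ , refl) → refl }) (b Fin.≟ a)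
(u , n) ⊨? φ ∧ ψ         = ((u , n) ⊨? φ) ×-dec ((u , n) ⊨? ψ)
(u , n) ⊨? φ ∨ ψ         = ((u , n) ⊨? φ) ⊎-dec ((u , n) ⊨? ψ)
([] , n) ⊨? X φ          = no λ ()
(a ∷ v , n) ⊨? X φ       = map′ (λ p → a , v , refl , p)
                                (λ { (_ , _ , refl , p) → p }) ((v , n) ⊨? φ)
(u , n) ⊨? φ U ψ         = split? (λ y z → ((z , n) ⊨? ψ) ×-dec
                             All.all? (λ y″ → (y″ ++ z , n) ⊨? φ) (suffixes⁺ y)) u
(u , n) ⊨? φ U≤N ψ       = split? (λ y z → ((z , n) ⊨? ψ) ×-dec
                             (length (filter (λ y″ → ¬? ((y″ ++ z , n) ⊨? φ)) (suffixes⁺ y)) ℕ.≤? n)) u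
([] , n) ⊨? Ω            = yes refl
(_ ∷ _ , n) ⊨? Ω         = no λ ()

private
  length-suffixes⁺ : ∀ {A : Set} (y : List A) → length (suffixes⁺ y) ≡ length y
  length-suffixes⁺ []      = refl
  length-suffixes⁺ (_ ∷ y) = cong suc (length-suffixes⁺ y)

  suffixes⁺-short : ∀ {A : Set} (y z : List A) {K} → length (y ++ z) ≤ K →
                    All (λ y″ → length (y″ ++ z) ≤ K) (suffixes⁺ y)
  suffixes⁺-short []      z le = []
  suffixes⁺-short (a ∷ y) z le = le ∷ suffixes⁺-short y z (ℕ.≤-trans (ℕ.n≤1+n _) le)

  count-mono : ∀ {A : Set} {P Q : Pred A 0ℓ} (P? : Decidable P) (Q? : Decidable Q) {xs} →
               All (λ x → Q x → P x) xs → length (filter Q? xs) ≤ length (filter P? xs)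
  count-mono P? Q? [] = z≤n
  count-mono P? Q? (_∷_ {x} h hs) with Q? x | P? x
  ... | yes q | yes p = s≤s (count-mono P? Q? hs)
  ... | yes q | no ¬p = contradiction (h q) ¬p
  ... | no ¬q | yes p = ℕ.m≤n⇒m≤1+n (count-mono P? Q? hs)
  ... | no ¬q | no ¬p = count-mono P? Q? hs

  suffix-short : ∀ {A : Set} (y z : List A) {K} → length (y ++ z) ≤ K → length z ≤ K
  suffix-short []      z le = le
  suffix-short (_ ∷ y) z le = suffix-short y z (ℕ.≤-trans (ℕ.n≤1+n _) le)

  prefix-short : ∀ {A : Set} (y z : List A) {K} → length (y ++ z) ≤ K → length y ≤ K
  prefix-short y z le = ℕ.m+n≤o⇒m≤o (length y) (subst (_≤ _) (length-++ y) le)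

  truncate : ∀ {k} (φ : LTL≤ k) {u n K} → length u ≤ K →
             (u , n) ⊨ φ → (u , n ⊓ K) ⊨ φ
  truncate (letter a) le p        = p
  truncate (φ ∧ ψ)    le (p , q)  = truncate φ le p , truncate ψ le q
  truncate (φ ∨ ψ)    le (inj₁ p) = inj₁ (truncate φ le p)
  truncate (φ ∨ ψ)    le (inj₂ q) = inj₂ (truncate ψ le q)
  truncate (X φ)      le (a , v , refl , p) =
    a , v , refl , truncate φ (ℕ.≤-trans (ℕ.n≤1+n _) le) p
  truncate (φ U ψ)    le (y , z , refl , q , ps) =
    y , z , refl , truncate ψ (suffix-short y z le) q ,
    All.zipWith (λ (s , p) → truncate φ s p) (suffixes⁺-short y z le , ps)
  truncate (φ U≤N ψ) {n = n} {K} le (y , z , refl , q , c) =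
    y , z , refl , truncate ψ (suffix-short y z le) q ,
    ℕ.⊓-glb
      (ℕ.≤-trans
        (count-mono _ _ (All.map (λ s ¬p p → ¬p (truncate φ s p)) (suffixes⁺-short y z le)))
        c)
      (ℕ.≤-trans (length-filter (λ y″ → ¬? ((y″ ++ z , n ⊓ K) ⊨? φ)) (suffixes⁺ y))
        (subst (_≤ K) (sym (length-suffixes⁺ y)) (prefix-short y z le)))
  truncate Ω          le p        = p

models : ∀ {k} → LTL≤ k → Word k → Pred ℕ∞ 0ℓ
models φ u x = ∃ λ n → (u , n) ⊨ φ × x ≡ [ n ]

models-inf : ∀ {k} (φ : LTL≤ k) (u : Word k) → ∃ (IsInf (models φ u))
models-inf φ u = infimum (models φ u) (map [_] ns)
  (All.map⁺ (All.map (λ p → _ , p , refl) (All.all-filter sat? (upTo (suc (length u))))))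
  (λ { (n , p , refl) → lose
    (∈-map⁺ [_] (∈-filter⁺ sat? (∈-upTo⁺ (s≤s (ℕ.m⊓n≤n n (length u))))
                  (truncate φ ℕ.≤-refl p)))
    NonStrict.[ ℕ.m⊓n≤m n (length u) ] })
  where
  sat? : Decidable (λ n → (u , n) ⊨ φ)
  sat? n = (u , n) ⊨? φ

  ns : List ℕ
  ns = filter sat? (upTo (suc (length u)))

⟦_⟧ : ∀ {k} → LTL≤ k → Word k → ℕ∞
⟦ φ ⟧ u = proj₁ (models-inf φ u)

data Action : Set where
  ε ic r : Action

-- Act is the type of actions a transition may perform on a single counter:
-- Action for ordinary B-automata, List Action if non-atomic actions are allowed.
-- The list Δ stands for the finite set of its members.

record Automaton (k : ℕ) (Act : Set) : Set where
  field
    states counters : ℕ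
    In Final        : Subset states

  Transition : Set
  Transition = Fin states × Fin k × Vec Act counters × Fin states

  field
    Δ : List Transition

-- The result is the new value of the counter and the values recorded.

execute : Action → ℕ → ℕ × List ℕ
execute ε  v = v , []
execute ic v = suc v , suc v ∷ []
execute r  v = 0 , []

execute* : List Action → ℕ → ℕ × List ℕ
execute* []       v = v , []
execute* (α ∷ αs) v =
  let v′ , xs = execute α v
      v″ , ys = execute* αs v′
  in v″ , xs ++ ys

module _ {k : ℕ} {Act : Set} (𝒜 : Automaton k Act) where
  open Automaton 𝒜

  data Run : Fin states → Word k → Fin states → Set where
    []  : ∀ {p} → Run p [] p
    _∷_ : ∀ {p a σ q u s} → (p , a , σ , q) ∈ Δ → Run q u s → Run p (a ∷ u) s

  Accepting : ∀ {u} → (∃₂ λ p s → Run p u s) → Set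
  Accepting (p , s , e) = p ∈ₛ In × s ∈ₛ Final

module _ {k : ℕ} {Act : Set} (exec : Act → ℕ → ℕ × List ℕ) (𝒜 : Automaton k Act) where
  open Automaton 𝒜

  recorded : ∀ {p u s} → Run 𝒜 p u s → Vec ℕ counters → List ℕ
  recorded []                γ = []
  recorded (_∷_ {σ = σ} _ e) γ =
    let outcome = Vec.zipWith exec σ γ in
    concat (Vec.toList (Vec.map proj₂ outcome)) ++ recorded e (Vec.map proj₁ outcome)

  C : ∀ {u} → (∃₂ λ p s → Run 𝒜 p u s) → List ℕ
  C (_ , _ , e) = recorded e (Vec.replicate counters 0)

  -- The base value 0 is sup ∅.

  supC : ∀ {u} → (∃₂ λ p s → Run 𝒜 p u s) → ℕ∞
  supC ρ = [ max 0 (C ρ) ]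

  costs : Word k → Pred ℕ∞ 0ℓ
  costs u x = ∃ λ ρ → Accepting 𝒜 {u} ρ × x ≡ supC ρ

module _ {k : ℕ} {Act : Set} (𝒜 : Automaton k Act) where
  open Automaton 𝒜

  private
    extend : ∀ {p a u} (t : Transition) → t ∈ Δ → (∀ q → List (∃ (Run 𝒜 q u))) →
             List (∃ (Run 𝒜 p (a ∷ u)))
    extend {p} {a} (p′ , a′ , σ , q) t∈Δ rest with p′ Fin.≟ p | a′ Fin.≟ a
    ... | yes refl | yes refl = map (λ (s , e) → s , t∈Δ ∷ e) (rest q)
    ... | yes _    | no _     = []
    ... | no _     | _        = []

    extend-complete : ∀ {p a σ q u s} (t∈Δ : (p , a , σ , q) ∈ Δ) (e : Run 𝒜 q u s)
                      (rest : ∀ q → List (∃ (Run 𝒜 q u))) → (s , e) ∈ rest q →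
                      (s , t∈Δ ∷ e) ∈ extend (p , a , σ , q) t∈Δ rest
    extend-complete {p} {a} t∈Δ e rest e∈
      rewrite ≡-≟-identity Fin._≟_ {p} refl | ≡-≟-identity Fin._≟_ {a} refl =
      ∈-map⁺ (λ (s , e) → s , t∈Δ ∷ e) e∈

    runsFrom : ∀ u p → List (∃ (Run 𝒜 p u))
    runsFrom []      p = (p , []) ∷ []
    runsFrom (a ∷ u) p = concat (mapWith∈ Δ (λ {t} t∈Δ → extend t t∈Δ (runsFrom u)))

    runsFrom-complete : ∀ {u p s} (e : Run 𝒜 p u s) → (s , e) ∈ runsFrom u p
    runsFrom-complete         []        = here refl
    runsFrom-complete {a ∷ u} (t∈Δ ∷ e) = ∈-concat⁺′
      (extend-complete t∈Δ e (runsFrom u) (runsFrom-complete e))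
      (mapWith∈⁺ (λ {t} t∈Δ → extend t t∈Δ (runsFrom u)) (_ , t∈Δ , refl))

    runs : ∀ u → List (∃₂ λ p s → Run 𝒜 p u s)
    runs u = concat (map (λ p → map (p ,_) (runsFrom u p)) (allFin states))

    runs-complete : ∀ {u} (ρ : ∃₂ λ p s → Run 𝒜 p u s) → ρ ∈ runs u
    runs-complete (p , s , e) =
      ∈-concat⁺′ (∈-map⁺ (p ,_) (runsFrom-complete e)) (∈-map⁺ _ (∈-allFin p))

    accepting? : ∀ {u} → Decidable (Accepting 𝒜 {u})
    accepting? (p , s , e) = (p ∈ₛ? In) ×-dec (s ∈ₛ? Final)

  costs-inf : (exec : Act → ℕ → ℕ × List ℕ) (u : Word k) → ∃ (IsInf (costs exec 𝒜 u))
  costs-inf exec u = infimum (costs exec 𝒜 u)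
    (map (supC exec 𝒜) (filter accepting? (runs u)))
    (All.map⁺ (All.map (λ {ρ} acc → ρ , acc , refl) (All.all-filter accepting? (runs u))))
    (λ { (ρ , acc , refl) → lose
      (∈-map⁺ (supC exec 𝒜) (∈-filter⁺ accepting? (runs-complete ρ) acc)) ∞.≤-refl })

⟦_⟧B : ∀ {k} → Automaton k Action → Word k → ℕ∞
⟦ 𝒜 ⟧B u = proj₁ (costs-inf 𝒜 execute u)

⟦_⟧B* : ∀ {k} → Automaton k (List Action) → Word k → ℕ∞
⟦ 𝒜 ⟧B* u = proj₁ (costs-inf 𝒜 execute* u)

_Recognizes_^≈ : ∀ {k} → Automaton k Action → (Word k → ℕ∞) → Set₁
𝒜 Recognizes f ^≈ = ⟦ 𝒜 ⟧B ≈ f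

Regular_^≈ : ∀ {k} → (Word k → ℕ∞) → Set₁
Regular f ^≈ = ∃ λ 𝒜 → 𝒜 Recognizes f ^≈

{-# OPTIONS --safe #-}

-- An automaton guesses, before each letter, which subformulas hold at the current
-- position, and checks the guesses locally: φ U ψ needs ψ now, or φ now and φ U ψ
-- at the next position, and so on. The counter of φ U≤N ψ, during a maximal block
-- of positions where φ U≤N ψ is claimed but ψ is not, counts the positions where φ
-- is not claimed; it is reset as soon as the block ends. The actions are determined
-- by the guess at a single position, so atomic actions suffice for exact values.

module Submission where

open import Defs
open import Data.Bool.Base using (Bool; true; false; T)
open import Data.Bool.Properties using (T?; T-≡)
open import Data.Empty using (⊥)
open import Data.Fin.Base using (Fin; finToFun; funToFin)
import Data.Fin.Properties as Fin
open import Data.Fin.Subset using (Subset) renaming (_∈_ to _∈ₛ_)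
open import Data.List.Base
  using (List; []; _∷_; _++_; length; map; filter; concat; allFin; cartesianProduct; lookup)
open import Data.List.Extrema.Nat using (max; max≤v⁺; xs≤max)
open import Data.List.Membership.Propositional using (_∈_)
open import Data.List.Membership.Propositional.Properties
  using (∈-map⁺; ∈-map⁻; ∈-filter⁺; ∈-filter⁻; ∈-++⁺ˡ; ∈-++⁺ʳ; ∈-++⁻; ∈-allFin;
         ∈-cartesianProduct⁺)
open import Data.List.Properties using (filter-accept; filter-reject)
open import Data.List.Relation.Unary.All using (All; []; _∷_)
import Data.List.Relation.Unary.All.Properties as All
open import Data.List.Relation.Unary.Any using (here; there; index)
open import Data.List.Relation.Unary.Any.Properties using (lookup-index)
open import Data.Nat.Base using (ℕ; suc; pred; _∸_; _^_; _≤_; _<_; z≤n; s≤s)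
import Data.Nat.Properties as ℕ
open import Data.Product.Base using (_×_; _,_; ∃; ∃₂; ∃-syntax; proj₁; proj₂)
open import Data.Sum.Base using (_⊎_; inj₁; inj₂)
open import Data.Unit.Base using (tt)
open import Data.Vec.Base as Vec using (Vec; []; _∷_)
import Data.Vec.Properties as Vec
import Data.Vec.Relation.Unary.All as VecAll
import Data.Vec.Relation.Unary.All.Properties as VecAll
open import Function.Base using (_∘_; id)
open import Function.Bundles using (Equivalence; Inverse)
open import Level using (0ℓ)
import Relation.Binary.Construct.Add.Supremum.NonStrict _≤_ as NonStrict
open import Relation.Binary.PropositionalEquality
  using (_≡_; refl; sym; trans; cong; subst)
open import Relation.Nullary using (Dec; ¬_; yes; no; contradiction)
open import Relation.Nullary.Construct.Add.Supremum using ([_])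
open import Relation.Nullary.Decidable
  using (map′; ¬?; _×-dec_; _⊎-dec_; _→-dec_; isYes; toWitness; fromWitness)
open import Relation.Unary using (Pred; Decidable)

-- Quantification and tabulation over list membership; decidable subsets.

module _ {A : Set} where

  -- `P` may depend on the membership proof: claims are attached to occurrences in a list, and a
  -- formula can occur more than once.
  ∀∈? : ∀ {xs : List A} {P : ∀ x → x ∈ xs → Set} →
        (∀ x x∈ → Dec (P x x∈)) → Dec (∀ x x∈ → P x x∈)
  ∀∈? {[]}     P? = yes λ _ ()
  ∀∈? {x ∷ xs} P? = map′
    (λ { (p , _) _ (here refl) → p ; (_ , ps) y (there y∈) → ps y y∈ })
    (λ ps → ps x (here refl) , λ y y∈ → ps y (there y∈))
    (P? x (here refl) ×-dec ∀∈? (λ y y∈ → P? y (there y∈)))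

  tabulate∈ : ∀ {B : Set} (xs : List A) → (∀ x → x ∈ xs → B) → Vec B (length xs)
  tabulate∈ []       f = []
  tabulate∈ (x ∷ xs) f = f x (here refl) ∷ tabulate∈ xs (λ y y∈ → f y (there y∈))

  lookup-tabulate∈ : ∀ {B : Set} {xs : List A} (f : ∀ x → x ∈ xs → B) {x} (x∈ : x ∈ xs) →
                     Vec.lookup (tabulate∈ xs f) (index x∈) ≡ f x x∈
  lookup-tabulate∈ f (here refl) = refl
  lookup-tabulate∈ f (there x∈)  = lookup-tabulate∈ (λ y y∈ → f y (there y∈)) x∈

  vecAll∈ : ∀ {B : Set} {P : Pred B 0ℓ} {xs : List A} (v : Vec B (length xs)) →
            (∀ x (x∈ : x ∈ xs) → P (Vec.lookup v (index x∈))) → VecAll.All P v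
  vecAll∈ {xs = []}     []      ps = VecAll.[]
  vecAll∈ {xs = x ∷ xs} (_ ∷ v) ps =
    ps x (here refl) VecAll.∷ vecAll∈ v (λ y y∈ → ps y (there y∈))

module _ {n : ℕ} {P : Pred (Fin n) 0ℓ} (P? : Decidable P) where

  subsetOf : Subset n
  subsetOf = Vec.tabulate (λ i → isYes (P? i))

  ∈-subsetOf⁺ : ∀ {i} → P i → i ∈ₛ subsetOf
  ∈-subsetOf⁺ {i} p = Vec.lookup⇒[]= i subsetOf
    (trans (Vec.lookup∘tabulate _ i) (Equivalence.to T-≡ (fromWitness p)))

  ∈-subsetOf⁻ : ∀ {i} → i ∈ₛ subsetOf → P i
  ∈-subsetOf⁻ {i} i∈ = toWitness (Equivalence.from T-≡
    (trans (sym (Vec.lookup∘tabulate _ i)) (Vec.[]=⇒lookup i∈)))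

-- The arguments are the claims of φ U≤N ψ, ψ and φ.

count : Bool → Bool → Bool → Action
count true false false = ic
count true false true  = ε
count _    _     _     = r

-- Satisfaction and error budgets along one letter.

module _ {k : ℕ} where

  -- The empty word splits only trivially, so no error can occur and the parameter has nothing to
  -- bound. This is what allows final states to be chosen without knowing `n`.
  ⊨-[]-irrelevant : ∀ (φ : LTL≤ k) {n n′} → ([] , n) ⊨ φ → ([] , n′) ⊨ φ
  ⊨-[]-irrelevant (letter a) (_ , ())
  ⊨-[]-irrelevant (φ ∧ ψ)  (p , q)  = ⊨-[]-irrelevant φ p , ⊨-[]-irrelevant ψ q
  ⊨-[]-irrelevant (φ ∨ ψ)  (inj₁ p) = inj₁ (⊨-[]-irrelevant φ p)
  ⊨-[]-irrelevant (φ ∨ ψ)  (inj₂ q) = inj₂ (⊨-[]-irrelevant ψ q)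
  ⊨-[]-irrelevant (X φ)    (_ , _ , () , _)
  ⊨-[]-irrelevant (φ U ψ)  ([] , [] , refl , q , []) =
    [] , [] , refl , ⊨-[]-irrelevant ψ q , []
  ⊨-[]-irrelevant (φ U≤N ψ) ([] , [] , refl , q , _) =
    [] , [] , refl , ⊨-[]-irrelevant ψ q , z≤n
  ⊨-[]-irrelevant Ω        p        = p

  module _ {φ ψ : LTL≤ k} {n : ℕ} {u : Word k} where

    U-now : (u , n) ⊨ ψ → (u , n) ⊨ φ U ψ
    U-now q = [] , _ , refl , q , []

    U-cons⁺ : ∀ {a} → (a ∷ u , n) ⊨ φ → (u , n) ⊨ φ U ψ → (a ∷ u , n) ⊨ φ U ψ
    U-cons⁺ p (y , z , refl , q , ps) = _ ∷ y , z , refl , q , p ∷ ps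

    U-cons⁻ : ∀ {a} → (a ∷ u , n) ⊨ φ U ψ →
              (a ∷ u , n) ⊨ ψ ⊎ ((a ∷ u , n) ⊨ φ × (u , n) ⊨ φ U ψ)
    U-cons⁻ ([]    , z , refl , q , [])     = inj₁ q
    U-cons⁻ (_ ∷ y , z , refl , q , p ∷ ps) = inj₂ (p , y , z , refl , q , ps)

  Miss? : ∀ n φ (z : Word k) → Decidable (λ y″ → ¬ (y″ ++ z , n) ⊨ φ)
  Miss? n φ z y″ = ¬? ((y″ ++ z , n) ⊨? φ)

  -- (u , n) ⊨ φ U≤N ψ is Within n n φ ψ u. The two roles of n are separated
  -- since errors already counted reduce the budget b but not the parameter n.

  Within : (n b : ℕ) (φ ψ : LTL≤ k) → Word k → Set
  Within n b φ ψ u = ∃₂ λ y z → u ≡ y ++ z × (z , n) ⊨ ψ ×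
    length (filter (Miss? n φ z) (suffixes⁺ y)) ≤ b

  module _ {φ ψ : LTL≤ k} {n : ℕ} where

    Within-now : ∀ {b u} → (u , n) ⊨ ψ → Within n b φ ψ u
    Within-now q = [] , _ , refl , q , z≤n

    Within-mono : ∀ {b b′ u} → b ≤ b′ → Within n b φ ψ u → Within n b′ φ ψ u
    Within-mono b≤b′ (y , z , eq , q , le) = y , z , eq , q , ℕ.≤-trans le b≤b′

    Within-hit⁺ : ∀ {a b u} → (a ∷ u , n) ⊨ φ → Within n b φ ψ u → Within n b φ ψ (a ∷ u)
    Within-hit⁺ {a} {b} p (y , z , refl , q , le) = a ∷ y , z , refl , q ,
      subst (_≤ b) (cong length (sym (filter-reject (Miss? n φ z) (λ ¬p → ¬p p)))) le

    -- The failure of φ at the head is not assumed: an automaton that does not claim φ pays for an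
    -- error even if φ holds there, and then the bound is merely slack.
    Within-miss⁺ : ∀ {a b u} → Within n b φ ψ u → Within n (suc b) φ ψ (a ∷ u)
    Within-miss⁺ {a} {b} (y , z , refl , q , le) = a ∷ y , z , refl , q , bound
      where
      bound : length (filter (Miss? n φ z) (suffixes⁺ (a ∷ y))) ≤ suc b
      bound with (a ∷ y ++ z , n) ⊨? φ
      ... | yes _ = ℕ.m≤n⇒m≤1+n le
      ... | no  _ = s≤s le

    Within-hit⁻ : ∀ {a b u} → ¬ (a ∷ u , n) ⊨ ψ → (a ∷ u , n) ⊨ φ →
                  Within n b φ ψ (a ∷ u) → Within n b φ ψ u
    Within-hit⁻ ¬q p ([]    , z , refl , q , _) = contradiction q ¬q
    Within-hit⁻ {b = b} ¬q p (_ ∷ y , z , refl , q , le) = y , z , refl , q ,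
      subst (_≤ b) (cong length (filter-reject (Miss? n φ z) (λ ¬p → ¬p p))) le

    Within-miss⁻ : ∀ {a b u} → ¬ (a ∷ u , n) ⊨ ψ → ¬ (a ∷ u , n) ⊨ φ →
                   Within n b φ ψ (a ∷ u) → 0 < b × Within n (pred b) φ ψ u
    Within-miss⁻ ¬q ¬p ([]    , z , refl , q , _) = contradiction q ¬q
    Within-miss⁻ {b = b} ¬q ¬p (_ ∷ y , z , refl , q , le)
      with le′ ← subst (_≤ b) (cong length (filter-accept (Miss? n φ z) ¬p)) le
      = ℕ.≤-trans (s≤s z≤n) le′ , y , z , refl , q , ℕ.pred-mono-≤ le′

    -- v is the value of the counter, b, b₂ and b₁ are as in count, and Q is the
    -- claim of φ U≤N ψ at the next position.

    Within-count⁺ : ∀ b b₂ b₁ {a u v} {Q : Set} → T b → T b₂ ⊎ Q →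
               (T b₂ → (a ∷ u , n) ⊨ ψ) → (T b₁ → (a ∷ u , n) ⊨ φ) →
               All (_≤ n) (proj₂ (execute (count b b₂ b₁) v)) →
               (Q → Within n (n ∸ proj₁ (execute (count b b₂ b₁) v)) φ ψ u) →
               Within n (n ∸ v) φ ψ (a ∷ u)
    Within-count⁺ _    _     _     _ (inj₁ c₂) h₂ h₁ _          rest = Within-now (h₂ c₂)
    Within-count⁺ true true  _     _ (inj₂ c′) h₂ h₁ _          rest = Within-now (h₂ tt)
    Within-count⁺ true false true  _ (inj₂ c′) h₂ h₁ _          rest = Within-hit⁺ (h₁ tt) (rest c′)
    Within-count⁺ true false false {v = v} _ (inj₂ c′) h₂ h₁ (v<n ∷ _) rest =
      -- The recorded value `suc v` is at most `n`, so truncated subtraction loses nothing and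
      -- `suc (n ∸ suc v)` is at most `n ∸ v`.
      Within-mono (ℕ.∸-monoʳ-< (ℕ.n<1+n v) v<n) (Within-miss⁺ (rest c′))

    -- Meant for claims that agree with the truth: an increment then happens only where ψ and φ both
    -- fail, so it is an unavoidable error for which the budget must have had room.
    Within-count⁻ : ∀ b b₂ b₁ {a u v} →
      ((a ∷ u , n) ⊨ ψ → T b₂) → ((a ∷ u , n) ⊨ φ → T b₁) → (T b₁ → (a ∷ u , n) ⊨ φ) →
      (T b → Within n (n ∸ v) φ ψ (a ∷ u)) →
      All (_≤ n) (proj₂ (execute (count b b₂ b₁) v)) ×
      ((u , n) ⊨ φ U≤N ψ → Within n (n ∸ proj₁ (execute (count b b₂ b₁) v)) φ ψ u)
    -- A reset restores the budget to `n ∸ 0`, which is `n`, so what is required of the next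
    -- position is just the semantics of `φ U≤N ψ`.
    Within-count⁻ false _     _     _ _ _ _ = [] , λ h → h
    Within-count⁻ true  true  _     _ _ _ _ = [] , λ h → h
    Within-count⁻ true  false true  q⇒ _ ⇒p h = [] , λ _ → Within-hit⁻ q⇒ (⇒p tt) (h tt)
    Within-count⁻ true  false false {u = u} {v} q⇒ p⇒ _ h =
      let 0<n∸v , h′ = Within-miss⁻ q⇒ p⇒ (h tt) in
      ℕ.m∸n≢0⇒n<m (ℕ.n>0⇒n≢0 0<n∸v) ∷ [] ,
      λ _ → subst (λ b → Within n b φ ψ u) (ℕ.pred[m∸n]≡m∸[1+n] n v) h′

    U≤N-cons⁻ : ∀ {a u} → (a ∷ u , n) ⊨ φ U≤N ψ → (a ∷ u , n) ⊨ ψ ⊎ (u , n) ⊨ φ U≤N ψ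
    U≤N-cons⁻ {a} {u} h with (a ∷ u , n) ⊨? ψ | (a ∷ u , n) ⊨? φ
    ... | yes q | _     = inj₁ q
    ... | no ¬q | yes p = inj₂ (Within-hit⁻ ¬q p h)
    ... | no ¬q | no ¬p = inj₂ (Within-mono ℕ.pred[n]≤n (proj₂ (Within-miss⁻ ¬q ¬p h)))

  -- Subformulas and closure under operands.

  operands : LTL≤ k → List (LTL≤ k)
  operands (letter _) = []
  operands (φ ∧ ψ)    = φ ∷ ψ ∷ []
  operands (φ ∨ ψ)    = φ ∷ ψ ∷ []
  operands (X φ)      = φ ∷ []
  operands (φ U ψ)    = φ ∷ ψ ∷ []
  operands (φ U≤N ψ)  = φ ∷ ψ ∷ []
  operands Ω          = []

  pattern 1st = here refl
  pattern 2nd = there (here refl)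

  -- With the head split off, `φ ∈ subformulas φ` is `here refl` without a case distinction on `φ`.
  subformulas properSubformulas : LTL≤ k → List (LTL≤ k)
  subformulas φ = φ ∷ properSubformulas φ
  properSubformulas (letter _) = []
  properSubformulas (φ ∧ ψ)    = subformulas φ ++ subformulas ψ
  properSubformulas (φ ∨ ψ)    = subformulas φ ++ subformulas ψ
  properSubformulas (X φ)      = subformulas φ
  properSubformulas (φ U ψ)    = subformulas φ ++ subformulas ψ
  properSubformulas (φ U≤N ψ)  = subformulas φ ++ subformulas ψ
  properSubformulas Ω          = []

  operand-proper : ∀ φ {θ} → θ ∈ operands φ → θ ∈ properSubformulas φ
  operand-proper (φ ∧ ψ)   1st = ∈-++⁺ˡ {xs = subformulas φ} (here refl)
  operand-proper (φ ∧ ψ)   2nd = ∈-++⁺ʳ (subformulas φ) (here refl)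
  operand-proper (φ ∨ ψ)   1st = ∈-++⁺ˡ {xs = subformulas φ} (here refl)
  operand-proper (φ ∨ ψ)   2nd = ∈-++⁺ʳ (subformulas φ) (here refl)
  operand-proper (X φ)     1st = here refl
  operand-proper (φ U ψ)   1st = ∈-++⁺ˡ {xs = subformulas φ} (here refl)
  operand-proper (φ U ψ)   2nd = ∈-++⁺ʳ (subformulas φ) (here refl)
  operand-proper (φ U≤N ψ) 1st = ∈-++⁺ˡ {xs = subformulas φ} (here refl)
  operand-proper (φ U≤N ψ) 2nd = ∈-++⁺ʳ (subformulas φ) (here refl)

  Closed : List (LTL≤ k) → Set
  Closed xs = ∀ {χ θ} → χ ∈ xs → θ ∈ operands χ → θ ∈ xs

  subformulas-closed       : ∀ φ → Closed (subformulas φ)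
  properSubformulas-closed : ∀ φ → Closed (properSubformulas φ)
  subformulas-++-closed    : ∀ φ ψ → Closed (subformulas φ ++ subformulas ψ)
  subformulas-closed φ (here refl) θ∈ = there (operand-proper φ θ∈)
  subformulas-closed φ (there χ∈)  θ∈ = there (properSubformulas-closed φ χ∈ θ∈)
  properSubformulas-closed (φ ∧ ψ)   = subformulas-++-closed φ ψ
  properSubformulas-closed (φ ∨ ψ)   = subformulas-++-closed φ ψ
  properSubformulas-closed (X φ)     = subformulas-closed φ
  properSubformulas-closed (φ U ψ)   = subformulas-++-closed φ ψ
  properSubformulas-closed (φ U≤N ψ) = subformulas-++-closed φ ψ
  subformulas-++-closed φ ψ χ∈ θ∈ with ∈-++⁻ (subformulas φ) χ∈
  ... | inj₁ χ∈φ = ∈-++⁺ˡ (subformulas-closed φ χ∈φ θ∈)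
  ... | inj₂ χ∈ψ = ∈-++⁺ʳ (subformulas φ) (subformulas-closed ψ χ∈ψ θ∈)

-- The automaton of claims.

module Construction
  {k : ℕ} {cl : List (LTL≤ k)} (operand : Closed cl) {root : LTL≤ k} (root∈cl : root ∈ cl)
  {Act : Set} (atom : Action → Act) (exec : Act → ℕ → ℕ × List ℕ)
  (exec-atom : ∀ α v → exec (atom α) v ≡ execute α v) where

  -- A state is a set of claims, one bit for each occurrence in `cl`, coded as a number through
  -- functions into `Fin 2`.
  State : Set
  State = Fin (2 ^ length cl)

  encode : (Fin (length cl) → Bool) → State
  encode f = funToFin (Inverse.from Fin.2↔Bool ∘ f)

  value : ∀ {χ} → State → χ ∈ cl → Bool
  value p m = Inverse.to Fin.2↔Bool (finToFun p (index m))

  value-encode : ∀ f {χ} (m : χ ∈ cl) → value (encode f) m ≡ f (index m)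
  value-encode f m = trans
    (cong (Inverse.to Fin.2↔Bool) (Fin.finToFun-funToFin (Inverse.from Fin.2↔Bool ∘ f) (index m)))
    (Inverse.strictlyInverseˡ Fin.2↔Bool (f (index m)))

  Claims : ∀ {χ} → State → χ ∈ cl → Set
  Claims p m = T (value p m)

  -- Imposed only on claims that are made. An absent claim asserts nothing, which is safe because
  -- satisfaction never requires an operand to fail.
  Local : ∀ χ → χ ∈ cl → State → Fin k → State → Set
  Local (letter b) m p a q = a ≡ b
  Local (φ ∧ ψ)    m p a q = Claims p (operand m 1st) × Claims p (operand m 2nd)
  Local (φ ∨ ψ)    m p a q = Claims p (operand m 1st) ⊎ Claims p (operand m 2nd)
  Local (X φ)      m p a q = Claims q (operand m 1st)
  Local (φ U ψ)    m p a q = Claims p (operand m 2nd) ⊎ (Claims p (operand m 1st) × Claims q m)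
  -- Not claiming φ is permitted here; the counter charges for it.
  Local (φ U≤N ψ)  m p a q = Claims p (operand m 2nd) ⊎ Claims q m
  Local Ω          m p a q = ⊥

  Local? : ∀ χ m p a q → Dec (Local χ m p a q)
  Local? (letter b) m p a q = a Fin.≟ b
  Local? (φ ∧ ψ)    m p a q = T? _ ×-dec T? _
  Local? (φ ∨ ψ)    m p a q = T? _ ⊎-dec T? _
  Local? (X φ)      m p a q = T? _
  Local? (φ U ψ)    m p a q = T? _ ⊎-dec (T? _ ×-dec T? _)
  Local? (φ U≤N ψ)  m p a q = T? _ ⊎-dec T? _
  Local? Ω          m p a q = no λ ()

  action : ∀ χ → χ ∈ cl → State → Action
  action (φ U≤N ψ) m p = count (value p m) (value p (operand m 2nd)) (value p (operand m 1st))
  -- Every occurrence in `cl` has a counter, so that one index serves for claims and counters; those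
  -- of other formulas never record a value.
  action _ m p = r

  actions : State → Vec Act (length cl)
  actions p = tabulate∈ cl (λ χ m → atom (action χ m p))

  Step : State × Fin k × State → Set
  Step (p , a , q) = ∀ χ (m : χ ∈ cl) → Claims p m → Local χ m p a q

  Step? : Decidable Step
  Step? (p , a , q) = ∀∈? λ χ m → T? _ →-dec Local? χ m p a q

  Initial : Pred State 0ℓ
  Initial p = Claims p root∈cl

  Initial? : Decidable Initial
  Initial? p = T? _

  -- The parameter 0 is an arbitrary choice, by `⊨-[]-irrelevant`.
  Terminal : Pred State 0ℓ
  Terminal p = ∀ χ (m : χ ∈ cl) → Claims p m → ([] , 0) ⊨ χ

  Terminal? : Decidable Terminal
  Terminal? p = ∀∈? λ χ m → T? _ →-dec (([] , 0) ⊨? χ)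

  triples : List (State × Fin k × State)
  triples = cartesianProduct (allFin _) (cartesianProduct (allFin k) (allFin _))

  automaton : Automaton k Act
  automaton = record
    { states   = 2 ^ length cl
    ; counters = length cl
    ; In       = subsetOf Initial?
    ; Final    = subsetOf Terminal?
    ; Δ        = map (λ (p , a , q) → p , a , actions p , q) (filter Step? triples)
    }

  -- Transitions and counter updates.

  open Automaton automaton using (Δ)

  ∈Δ⁺ : ∀ {p a q} → Step (p , a , q) → (p , a , actions p , q) ∈ Δ
  ∈Δ⁺ {p} {a} {q} s = ∈-map⁺ _ (∈-filter⁺ Step?
    (∈-cartesianProduct⁺ (∈-allFin p) (∈-cartesianProduct⁺ (∈-allFin a) (∈-allFin q))) s)

  ∈Δ⁻ : ∀ {p a σ q} → (p , a , σ , q) ∈ Δ → Step (p , a , q) × σ ≡ actions p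
  ∈Δ⁻ t∈ with (_ , s∈ , refl) ← ∈-map⁻ _ t∈ = proj₂ (∈-filter⁻ Step? {xs = triples} s∈) , refl

  outcome : State → Vec ℕ (length cl) → Vec (ℕ × List ℕ) (length cl)
  outcome p γ = Vec.zipWith exec (actions p) γ

  lookup-outcome : ∀ {B : Set} (f : ℕ × List ℕ → B) p γ {χ} (m : χ ∈ cl) →
                   Vec.lookup (Vec.map f (outcome p γ)) (index m) ≡
                   f (execute (action χ m p) (Vec.lookup γ (index m)))
  lookup-outcome f p γ {χ} m
    rewrite Vec.lookup-map (index m) f (outcome p γ)
          | Vec.lookup-zipWith exec (index m) (actions p) γ
          | lookup-tabulate∈ (λ χ m → atom (action χ m p)) m
          | exec-atom (action χ m p) (Vec.lookup γ (index m)) = refl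

  after : State → Vec ℕ (length cl) → Vec ℕ (length cl)
  after p γ = Vec.map proj₁ (outcome p γ)

  writtenEach : State → Vec ℕ (length cl) → Vec (List ℕ) (length cl)
  writtenEach p γ = Vec.map proj₂ (outcome p γ)

  written : State → Vec ℕ (length cl) → List ℕ
  written p γ = concat (Vec.toList (writtenEach p γ))

  module _ {n : ℕ} {p : State} {γ : Vec ℕ (length cl)} where

    written⁺ : (∀ χ (m : χ ∈ cl) →
                All (_≤ n) (proj₂ (execute (action χ m p) (Vec.lookup γ (index m))))) →
               All (_≤ n) (written p γ)
    written⁺ h = All.concat⁺ (VecAll.toList⁺ (vecAll∈ (writtenEach p γ) λ χ m →
      subst (All (_≤ n)) (sym (lookup-outcome proj₂ p γ m)) (h χ m)))

    written⁻ : All (_≤ n) (written p γ) → ∀ {χ} (m : χ ∈ cl) →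
               All (_≤ n) (proj₂ (execute (action χ m p) (Vec.lookup γ (index m))))
    written⁻ h m = subst (All (_≤ n)) (lookup-outcome proj₂ p γ m)
      (VecAll.lookup⁺
        (VecAll.toList⁻ (All.concat⁻ {xss = Vec.toList (writtenEach p γ)} h)) (index m))

  -- Soundness of the claims along a run.

  module Soundness (n : ℕ) where

    -- Mutual induction: a call either shortens the run or, at the same position, passes to an
    -- operand. The counters `γ` are arbitrary because the induction resumes with those reached
    -- after a step.
    sound : ∀ χ (m : χ ∈ cl) {p u s} (e : Run automaton p u s) γ → Terminal s →
            All (_≤ n) (recorded exec automaton e γ) → Claims p m → (u , n) ⊨ χ

    sound-∷ : ∀ χ (m : χ ∈ cl) {p a q u s} → Step (p , a , q) →
              (e : Run automaton q u s) → ∀ γ → Terminal s →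
              All (_≤ n) (written p γ ++ recorded exec automaton e (after p γ)) →
              Claims p m → (a ∷ u , n) ⊨ χ

    -- The strengthening that carries the induction for `U≤N`: errors already on the counter are
    -- deducted from the budget.
    within : ∀ φ ψ (m : φ U≤N ψ ∈ cl) {p u s} (e : Run automaton p u s) γ → Terminal s →
             All (_≤ n) (recorded exec automaton e γ) → Claims p m →
             Within n (n ∸ Vec.lookup γ (index m)) φ ψ u

    within-∷ : ∀ φ ψ (m : φ U≤N ψ ∈ cl) {p a q u s} → Step (p , a , q) →
               (e : Run automaton q u s) → ∀ γ → Terminal s →
               All (_≤ n) (written p γ ++ recorded exec automaton e (after p γ)) →
               Claims p m → Within n (n ∸ Vec.lookup γ (index m)) φ ψ (a ∷ u)

    sound χ m []       γ fin rec c = ⊨-[]-irrelevant χ (fin χ m c)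
    sound χ m (t∈ ∷ e) γ fin rec c with ∈Δ⁻ t∈
    ... | step , refl = sound-∷ χ m step e γ fin rec c

    sound-∷ (letter b) m step e γ fin rec c with refl ← step _ m c = _ , refl
    sound-∷ (φ ∧ ψ) m step e γ fin rec c with (c₁ , c₂) ← step _ m c =
      sound-∷ φ (operand m 1st) step e γ fin rec c₁ ,
      sound-∷ ψ (operand m 2nd) step e γ fin rec c₂
    sound-∷ (φ ∨ ψ) m step e γ fin rec c with step _ m c
    ... | inj₁ c₁ = inj₁ (sound-∷ φ (operand m 1st) step e γ fin rec c₁)
    ... | inj₂ c₂ = inj₂ (sound-∷ ψ (operand m 2nd) step e γ fin rec c₂)
    sound-∷ (X φ) m {p} step e γ fin rec c = _ , _ , refl ,
      sound φ (operand m 1st) e (after p γ) fin (All.++⁻ʳ (written p γ) rec) (step _ m c)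
    sound-∷ (φ U ψ) m {p} step e γ fin rec c with step _ m c
    ... | inj₁ c₂        = U-now (sound-∷ ψ (operand m 2nd) step e γ fin rec c₂)
    ... | inj₂ (c₁ , c′) =
      U-cons⁺ (sound-∷ φ (operand m 1st) step e γ fin rec c₁)
              (sound (φ U ψ) m e (after p γ) fin (All.++⁻ʳ (written p γ) rec) c′)
    sound-∷ (φ U≤N ψ) m step e γ fin rec c =
      Within-mono (ℕ.m∸n≤m n (Vec.lookup γ (index m))) (within-∷ φ ψ m step e γ fin rec c)
    sound-∷ Ω m step e γ fin rec c with () ← step _ m c

    within φ ψ m []       γ fin rec c with ([] , [] , refl , q , _) ← fin _ m c =
      Within-now (⊨-[]-irrelevant ψ q)
    within φ ψ m (t∈ ∷ e) γ fin rec c with ∈Δ⁻ t∈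
    ... | step , refl = within-∷ φ ψ m step e γ fin rec c

    within-∷ φ ψ m {p} step e γ fin rec c = Within-count⁺
      (value p m) (value p (operand m 2nd)) (value p (operand m 1st))
      {v = Vec.lookup γ (index m)} c (step _ m c)
      (sound-∷ ψ (operand m 2nd) step e γ fin rec) (sound-∷ φ (operand m 1st) step e γ fin rec)
      (written⁻ (All.++⁻ˡ (written p γ) rec) m)
      (λ c′ → subst (λ v → Within n (n ∸ v) φ ψ _) (lookup-outcome proj₁ p γ m)
        (within φ ψ m e (after p γ) fin (All.++⁻ʳ (written p γ) rec) c′))

  -- Completeness: the run whose claims are the true formulas.

  module Completeness (n : ℕ) where

    -- Claiming everything that holds keeps the counters from charging for positions where φ holds;
    -- claiming nothing else makes every local check succeed.
    truth : Word k → State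
    truth u = encode (λ i → isYes ((u , n) ⊨? lookup cl i))

    truth⁺ : ∀ u {χ} (m : χ ∈ cl) → (u , n) ⊨ χ → Claims (truth u) m
    truth⁺ u m h = subst T (sym (value-encode _ m))
      (fromWitness (subst ((u , n) ⊨_) (lookup-index m) h))

    truth⁻ : ∀ u {χ} (m : χ ∈ cl) → Claims (truth u) m → (u , n) ⊨ χ
    truth⁻ u m c = subst ((u , n) ⊨_) (sym (lookup-index m))
      (toWitness (subst T (value-encode _ m) c))

    truth-step : ∀ a u → Step (truth (a ∷ u) , a , truth u)
    truth-step a u χ m c = local χ m (truth⁻ (a ∷ u) m c)
      where
      local : ∀ χ (m : χ ∈ cl) → (a ∷ u , n) ⊨ χ → Local χ m (truth (a ∷ u)) a (truth u)
      local (letter b) m (_ , refl)     = refl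
      local (φ ∧ ψ)    m (h₁ , h₂)      = truth⁺ (a ∷ u) (operand m 1st) h₁ ,
                                          truth⁺ (a ∷ u) (operand m 2nd) h₂
      local (φ ∨ ψ)    m (inj₁ h)       = inj₁ (truth⁺ (a ∷ u) (operand m 1st) h)
      local (φ ∨ ψ)    m (inj₂ h)       = inj₂ (truth⁺ (a ∷ u) (operand m 2nd) h)
      local (X φ)      m (_ , _ , refl , h) = truth⁺ u (operand m 1st) h
      local (φ U ψ)    m h with U-cons⁻ h
      ... | inj₁ h₂        = inj₁ (truth⁺ (a ∷ u) (operand m 2nd) h₂)
      ... | inj₂ (h₁ , h′) = inj₂ (truth⁺ (a ∷ u) (operand m 1st) h₁ , truth⁺ u m h′)
      local (φ U≤N ψ)  m h with U≤N-cons⁻ h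
      ... | inj₁ h₂ = inj₁ (truth⁺ (a ∷ u) (operand m 2nd) h₂)
      ... | inj₂ h′ = inj₂ (truth⁺ u m h′)

    truth-terminal : Terminal (truth [])
    truth-terminal χ m c = ⊨-[]-irrelevant χ (truth⁻ [] m c)

    run : ∀ u → Run automaton (truth u) u (truth [])
    run []      = []
    run (a ∷ u) = ∈Δ⁺ (truth-step a u) ∷ run u

    -- The invariant of the run. It restricts only counters of formulas that hold, since the counter
    -- of an unclaimed formula is reset at the next letter.
    Enough : Word k → Vec ℕ (length cl) → Set
    Enough u γ = ∀ φ ψ (m : φ U≤N ψ ∈ cl) → (u , n) ⊨ φ U≤N ψ →
                 Within n (n ∸ Vec.lookup γ (index m)) φ ψ u

    module _ {a : Fin k} {u : Word k} {γ : Vec ℕ (length cl)} (enough : Enough (a ∷ u) γ) where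

      private
        p : State
        p = truth (a ∷ u)

      execute-truth : ∀ φ ψ (m : φ U≤N ψ ∈ cl) →
        let v′ , vs = execute (action (φ U≤N ψ) m p) (Vec.lookup γ (index m)) in
        All (_≤ n) vs × ((u , n) ⊨ φ U≤N ψ → Within n (n ∸ v′) φ ψ u)
      execute-truth φ ψ m = Within-count⁻
        (value p m) (value p (operand m 2nd)) (value p (operand m 1st))
        (truth⁺ (a ∷ u) (operand m 2nd)) (truth⁺ (a ∷ u) (operand m 1st))
        (truth⁻ (a ∷ u) (operand m 1st)) (enough φ ψ m ∘ truth⁻ (a ∷ u) m)

      written-truth : All (_≤ n) (written p γ)
      written-truth = written⁺ {p = p} {γ} bound
        where
        bound : ∀ χ (m : χ ∈ cl) →
                All (_≤ n) (proj₂ (execute (action χ m p) (Vec.lookup γ (index m))))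
        bound (letter _) m = []
        bound (φ ∧ ψ)    m = []
        bound (φ ∨ ψ)    m = []
        bound (X φ)      m = []
        bound (φ U ψ)    m = []
        bound (φ U≤N ψ)  m = proj₁ (execute-truth φ ψ m)
        bound Ω          m = []

      enough-after : Enough u (after p γ)
      enough-after φ ψ m h =
        subst (λ v → Within n (n ∸ v) φ ψ u) (sym (lookup-outcome proj₁ p γ m))
          (proj₂ (execute-truth φ ψ m) h)

    recorded-run : ∀ u γ → Enough u γ → All (_≤ n) (recorded exec automaton (run u) γ)
    recorded-run []      γ enough = []
    recorded-run (a ∷ u) γ enough = All.++⁺ (written-truth enough)
      (recorded-run u (after (truth (a ∷ u)) γ) (enough-after enough))

  -- Equality of the two infima.

  initial : Vec ℕ (length cl)
  initial = Vec.replicate (length cl) 0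

  -- The largest recorded value bounds all of them, so soundness applies with that value as the
  -- parameter.
  run⇒model : ∀ {u} ρ → Accepting automaton {u} ρ →
              (u , max 0 (C exec automaton ρ)) ⊨ root
  run⇒model (p , s , e) (p∈ , s∈) = Soundness.sound _ root root∈cl e initial
    (∈-subsetOf⁻ Terminal? s∈) (xs≤max 0 (recorded exec automaton e initial))
    (∈-subsetOf⁻ Initial? p∈)

  model⇒run : ∀ {u n} → (u , n) ⊨ root →
              ∃ λ ρ → Accepting automaton {u} ρ × max 0 (C exec automaton ρ) ≤ n
  model⇒run {u} {n} h = (truth u , truth [] , run u) ,
    (∈-subsetOf⁺ Initial? (truth⁺ u root∈cl h) , ∈-subsetOf⁺ Terminal? truth-terminal) ,
    max≤v⁺ z≤n (recorded-run u initial enough)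
    where
    open Completeness n
    enough : Enough u initial
    -- All counters start at 0, so the budget is the full `n` and the invariant is the semantics
    -- itself.
    enough φ ψ m h = subst (λ v → Within n (n ∸ v) φ ψ u)
      (sym (Vec.lookup-replicate (index m) 0)) h

  -- Each infimum bounds the other: a parameter that satisfies `root` yields an accepting run of no
  -- larger value, and the value of an accepting run is itself such a parameter.
  exact : ∀ u → proj₁ (costs-inf automaton exec u) ≡ ⟦ root ⟧ u
  exact u = NonStrict.≤⁺-antisym-≡ ℕ.≤-antisym
    (Models.greatest λ { (n , h , refl) →
      let ρ , acc , le = model⇒run h in
      NonStrict.≤⁺-trans ℕ.≤-trans (Costs.lower (ρ , acc , refl)) NonStrict.[ le ] })
    (Costs.greatest λ { (ρ , acc , refl) → Models.lower (_ , run⇒model ρ acc , refl) })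
    where
    module Costs  = IsInf (proj₂ (costs-inf automaton exec u))
    module Models = IsInf (proj₂ (models-inf root u))

-- From exact values to cost functions.

≗⇒≼ : ∀ {k} {f g : Word k → ℕ∞} → (∀ u → f u ≡ g u) → f ≼ g
≗⇒≼ f≗g W (N , bound) = N , λ { (u , u∈W , refl) →
  subst (_<∞ [ N ]) (sym (f≗g u)) (bound (u , u∈W , refl)) }

execute*-[_] : ∀ α v → execute* (α ∷ []) v ≡ execute α v
execute*-[ ε ]  v = refl
execute*-[ ic ] v = refl
execute*-[ r ]  v = refl

theorem5p5 : ∀ (k : ℕ) (φ : LTL≤ k) →
    (∃[ 𝒜 ] 𝒜 Recognizes ⟦ φ ⟧ ^≈) ×
    Regular ⟦ φ ⟧ ^≈ ×
    (∃[ ℬ ] (∀ u → ⟦ ℬ ⟧B* u ≡ ⟦ φ ⟧ u))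
theorem5p5 k φ = recognized , recognized , NonAtomic.automaton , NonAtomic.exact
  where
  -- One construction gives both automata: atomic actions are kept as they are, or wrapped into
  -- one-element sequences.
  module Atomic = Construction (subformulas-closed φ) (here refl) id execute (λ _ _ → refl)
  module NonAtomic =
    Construction (subformulas-closed φ) (here refl) (_∷ []) execute* execute*-[_]

  recognized : ∃[ 𝒜 ] 𝒜 Recognizes ⟦ φ ⟧ ^≈
  recognized = Atomic.automaton , ≗⇒≼ Atomic.exact , ≗⇒≼ (sym ∘ Atomic.exact)
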